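{- $\pi_{C_5}(K_3)\le \frac{24}{625}$. Equivalently, $$\lim_{n\to\infty}\frac{\mathrm{ex}_{C_5}(n,\{K_3\})}{\binom{n}{5}}\le \frac{24}{625}.$$
   Context: All graphs are simple. For a graph $G$ on $n$ vertices and a graph $A$ on $k$ vertices, let $C_A(G)$ be the set of $k$-element subsets of $V(G)$ that induce a copy of $A$ in $G$. The $A$-density of $G$ is $d_A(G)=|C_A(G)|/\binom{n}{k}$. For a family $\mathcal{F}$ of forbidden graphs, set $$\mathrm{ex}_A(n,\mathcal{F})=\max\{|C_A(G)| : G \text{ is } \mathcal{F}\text{ -free},\ |V(G)|=n\},$$ where $\mathcal{F}$-free means containing no member of $\mathcal{F}$ as a subgraph. The Turán density is $\pi_A(\mathcal{F})=\lim_{n\to\infty}\mathrm{ex}_A(n,\mathcal{F})/\binom{n}{k}$; this limit exists. Here $A=C_5$ is the 5-cycle and $\mathcal{F}=\{K_3\}$. So $\pi_{C_5}(K_3)$ is the limit, as $n\to\infty$, of the maximum over triangle-free $n$-vertex graphs $G$ of the number of 5-vertex subsets inducing a $5$-cycle, divided by $\binom{n}{5}$. -}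

module Defs where

open import Level using (0ℓ)
open import Data.Bool.Base using (true; false)
open import Data.Empty using (⊥-elim)
open import Data.Fin.Base using (Fin; toℕ)
import Data.Fin.Properties as Fin
open import Data.Fin.Subset using (Subset; inside; outside; _∈_; ∣_∣)
open import Data.Fin.Subset.Properties using (_∈?_)
open import Data.Integer.Base using (+_)
open import Data.List.Base using (List; []; _∷_; [_]; length; map; filter; mapMaybe; cartesianProductWith)
open import Data.List.Extrema.Nat using (max; xs≤max; argmax-sel)
import Data.List.Membership.Propositional as List
open import Data.List.Membership.Propositional.Properties using (∈-cartesianProductWith⁺; ∈-map⁺; ∈-map⁻; ∈-filter⁺; ∈-filter⁻)
open import Data.List.Properties using (filter-≐)
open import Data.List.Relation.Unary.All as All using (All)
open import Data.List.Relation.Unary.Any as Any using (Any; here; there)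
import Data.List.Relation.Unary.Any.Properties as Any
open import Data.Maybe.Base using (Maybe; just; nothing)
import Data.Maybe.Relation.Unary.Any as Maybe
open import Data.Nat.Base as ℕ using (ℕ; zero; suc; _%_)
open import Data.Nat.Combinatorics using (_C_)
import Data.Nat.Properties as ℕ
open import Data.Product.Base using (Σ; ∃; _×_; _,_; proj₁; proj₂; map₂)
open import Data.Rational.Base as ℚ using (ℚ; 0ℚ; ½)
import Data.Rational.Properties as ℚ
open import Data.Rational.Solver using (module +-*-Solver)
open import Data.Sum.Base using (_⊎_; inj₁; inj₂; swap)
open import Data.Vec.Base using (Vec; []; _∷_; lookup; tabulate)
open import Data.Vec.Properties using (lookup∘tabulate; []=⇒lookup; lookup⇒[]=)
open import Function.Base using (_∘_)
open import Function.Bundles using (_⇔_; mk⇔; module Equivalence)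
open import Function.Definitions using (Injective)
open import Relation.Binary.Core using (Rel)
open import Relation.Binary.Definitions using (Symmetric; Decidable)
open import Relation.Binary.PropositionalEquality using (_≡_; _≢_; _≗_; refl; sym; trans; cong; subst; subst₂; ≢-sym)
open import Relation.Nullary using (¬_; Dec; yes; no; does; ¬?)
open import Relation.Nullary.Decidable using (map′; from-yes; _×-dec_; _⊎-dec_; _→-dec_; dec-true)
open import Relation.Unary using (Pred) renaming (Decidable to Decidable₁)

open Equivalence using (to; from)

private
  variable
    k n : ℕ

record Graph (n : ℕ) : Set₁ where
  infix 4 _~_ _~?_
  field
    _~_    : Rel (Fin n) 0ℓ
    ~-sym  : Symmetric _~_
    ~-irr  : ∀ i → ¬ (i ~ i)
    _~?_   : Decidable _~_

adj-syntax : (G : Graph n) → Rel (Fin n) 0ℓ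
adj-syntax = Graph._~_

infix 4 adj-syntax
syntax adj-syntax G i j = i ~[ G ] j

K₃ : Graph 3
K₃ = record
  { _~_   = _≢_
  ; ~-sym = ≢-sym
  ; ~-irr = λ i i≢i → i≢i refl
  ; _~?_  = λ i j → ¬? (i Fin.≟ j)
  }

C₅ : Graph 5
C₅ = record
  { _~_   = _~_
  ; ~-sym = swap
  ; ~-irr = from-yes (Fin.all? λ i → ¬? (i ~? i))
  ; _~?_  = _~?_
  }
  where
  _~_ : Rel (Fin 5) 0ℓ
  i ~ j = (toℕ j ≡ suc (toℕ i) % 5) ⊎ (toℕ i ≡ suc (toℕ j) % 5)

  _~?_ : Decidable _~_
  i ~? j = (toℕ j ℕ.≟ suc (toℕ i) % 5) ⊎-dec (toℕ i ℕ.≟ suc (toℕ j) % 5)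

-- φ is an isomorphism from A onto the subgraph of G induced by S.
record IsInducedCopy (A : Graph k) (G : Graph n) (S : Subset n) (φ : Fin k → Fin n) : Set where
  field
    injective : Injective _≡_ _≡_ φ
    image     : ∀ v → v ∈ S ⇔ (∃ λ i → φ i ≡ v)
    adjacency : ∀ i j → (i ~[ A ] j) ⇔ (φ i ~[ G ] φ j)

Induces : Graph k → Graph n → Subset n → Set
Induces A G S = ∃ (IsInducedCopy A G S)

record IsEmbedding (H : Graph k) (G : Graph n) (φ : Fin k → Fin n) : Set where
  field
    injective : Injective _≡_ _≡_ φ
    adjacency : ∀ i j → i ~[ H ] j → φ i ~[ G ] φ j

-- Not necessarily induced.
_⊑_ : Graph k → Graph n → Set
H ⊑ G = ∃ (IsEmbedding H G)

Family : Set₁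
Family = List (∃ Graph)

Free : Family → Graph n → Set₁
Free F G = All (λ H → ¬ (proj₂ H ⊑ G)) F

private
  infix 2 _⇔-dec_
  _⇔-dec_ : {P Q : Set} → Dec P → Dec Q → Dec (P ⇔ Q)
  p? ⇔-dec q? = map′ (λ (f , g) → mk⇔ f g) (λ e → to e , from e)
                     ((p? →-dec q?) ×-dec (q? →-dec p?))

  anyVec? : {P : Pred (Vec (Fin n) k) 0ℓ} → Decidable₁ P → Dec (∃ P)
  anyVec? {k = zero}  P? = map′ ([] ,_) (λ { ([] , p) → p }) (P? [])
  anyVec? {k = suc _} P? = map′ (λ (x , xs , p) → x ∷ xs , p) (λ { (x ∷ xs , p) → x , xs , p })
                                (Fin.any? λ x → anyVec? λ xs → P? (x ∷ xs))

  anyFun? : {P : Pred (Fin k → Fin n) 0ℓ} → (∀ {f g} → f ≗ g → P f → P g) →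
            Decidable₁ P → Dec (∃ P)
  anyFun? resp P? = map′ (λ (v , p) → lookup v , p)
                         (λ (f , p) → tabulate f , resp (sym ∘ lookup∘tabulate f) p)
                         (anyVec? (P? ∘ lookup))

  injective? : Decidable₁ {A = Fin k → Fin n} (Injective _≡_ _≡_)
  injective? φ = map′ (λ f {i} {j} → f i j) (λ f i j → f {i} {j})
    (Fin.all? λ i → Fin.all? λ j → (φ i Fin.≟ φ j) →-dec (i Fin.≟ j))

  injective-resp : {φ ψ : Fin k → Fin n} → φ ≗ ψ → Injective _≡_ _≡_ φ → Injective _≡_ _≡_ ψ
  injective-resp φ≗ψ inj eq = inj (trans (φ≗ψ _) (trans eq (sym (φ≗ψ _))))

  isInducedCopy-resp : (A : Graph k) (G : Graph n) (S : Subset n) {φ ψ : Fin k → Fin n} →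
                       φ ≗ ψ → IsInducedCopy A G S φ → IsInducedCopy A G S ψ
  isInducedCopy-resp A G S φ≗ψ c = record
    { injective = injective-resp φ≗ψ injective
    ; image     = λ v → mk⇔ (map₂ (λ {i} → trans (sym (φ≗ψ i))) ∘ to (image v))
                            (from (image v) ∘ map₂ (λ {i} → trans (φ≗ψ i)))
    ; adjacency = λ i j → subst₂ (λ x y → (i ~[ A ] j) ⇔ (x ~[ G ] y)) (φ≗ψ i) (φ≗ψ j) (adjacency i j)
    }
    where open IsInducedCopy c

  isInducedCopy? : (A : Graph k) (G : Graph n) (S : Subset n) → Decidable₁ (IsInducedCopy A G S)
  isInducedCopy? A G S φ =
    map′ (λ (p , q , r) → record { injective = λ {i} {j} → p {i} {j} ; image = q ; adjacency = r })
         (λ c → (λ {i} {j} → IsInducedCopy.injective c {i} {j}) , IsInducedCopy.image c , IsInducedCopy.adjacency c)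
         (injective? φ
          ×-dec (Fin.all? λ v → (v ∈? S) ⇔-dec (Fin.any? λ i → φ i Fin.≟ v))
          ×-dec (Fin.all? λ i → Fin.all? λ j → Graph._~?_ A i j ⇔-dec Graph._~?_ G (φ i) (φ j)))

  isEmbedding-resp : (H : Graph k) (G : Graph n) {φ ψ : Fin k → Fin n} →
                     φ ≗ ψ → IsEmbedding H G φ → IsEmbedding H G ψ
  isEmbedding-resp H G φ≗ψ e = record
    { injective = injective-resp φ≗ψ injective
    ; adjacency = λ i j → subst₂ (λ x y → x ~[ G ] y) (φ≗ψ i) (φ≗ψ j) ∘ adjacency i j
    }
    where open IsEmbedding e

  isEmbedding? : (H : Graph k) (G : Graph n) → Decidable₁ (IsEmbedding H G)
  isEmbedding? H G φ =
    map′ (λ (p , q) → record { injective = λ {i} {j} → p {i} {j} ; adjacency = q })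
         (λ e → (λ {i} {j} → IsEmbedding.injective e {i} {j}) , IsEmbedding.adjacency e)
         (injective? φ
          ×-dec (Fin.all? λ i → Fin.all? λ j → Graph._~?_ H i j →-dec Graph._~?_ G (φ i) (φ j)))

induces? : (A : Graph k) (G : Graph n) → Decidable₁ (Induces A G)
induces? A G S = anyFun? (isInducedCopy-resp A G S) (isInducedCopy? A G S)

_⊑?_ : (H : Graph k) (G : Graph n) → Dec (H ⊑ G)
H ⊑? G = anyFun? (isEmbedding-resp H G) (isEmbedding? H G)

free? : (F : Family) → Decidable₁ (Free {n} F)
free? F G = All.all? (λ H → ¬? (proj₂ H ⊑? G)) F

vecs : {A : Set} → List A → ∀ n → List (Vec A n)
vecs xs zero    = [ [] ]
vecs xs (suc n) = cartesianProductWith _∷_ xs (vecs xs n)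

subsets : ∀ n → List (Subset n)
subsets = vecs (outside ∷ inside ∷ [])

copies : Graph k → Graph n → List (Subset n)
copies {k} {n} A G = filter (λ S → (∣ S ∣ ℕ.≟ k) ×-dec induces? A G S) (subsets n)

#copies : Graph k → Graph n → ℕ
#copies A G = length (copies A G)

-- The graph in which the neighbourhood of i is the i-th entry of N,
-- provided this relation is symmetric and irreflexive.
fromNeighbourhoods : Vec (Subset n) n → Maybe (Graph n)
fromNeighbourhoods N
  with (Fin.all? λ i → Fin.all? λ j → (j ∈? lookup N i) →-dec (i ∈? lookup N j))
     | (Fin.all? λ i → ¬? (i ∈? lookup N i))
... | yes s | yes r = just (record
  { _~_   = λ i j → j ∈ lookup N i
  ; ~-sym = λ {i} {j} → s i j
  ; ~-irr = r
  ; _~?_  = λ i j → j ∈? lookup N i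
  })
... | yes _ | no _  = nothing
... | no _  | _     = nothing

graphs : ∀ n → List (Graph n)
graphs n = mapMaybe fromNeighbourhoods (vecs (subsets n) n)

-- ex-upper and ex-attained below show that this is the maximum over all
-- F-free graphs on n vertices; it is 0 if there are none.
ex : Graph k → Family → ℕ → ℕ
ex A F n = max 0 (map (#copies A) (filter (free? F) (graphs n)))

infix 4 _≈_
_≈_ : Graph n → Graph n → Set
G ≈ H = ∀ i j → (i ~[ G ] j) ⇔ (i ~[ H ] j)

private
  vecs-complete : {A : Set} {xs : List A} → (∀ x → x List.∈ xs) → (v : Vec A n) → v List.∈ vecs xs n
  vecs-complete all∈ []      = here refl
  vecs-complete all∈ (x ∷ v) = ∈-cartesianProductWith⁺ _∷_ (all∈ x) (vecs-complete all∈ v)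

subsets-complete : (S : Subset n) → S List.∈ subsets n
subsets-complete = vecs-complete λ { false → here refl ; true → there (here refl) }

private
  neighbourhoods : Graph n → Vec (Subset n) n
  neighbourhoods G = tabulate λ i → tabulate λ j → does (Graph._~?_ G i j)

  ∈-neighbourhoods : (G : Graph n) → ∀ i j → (i ~[ G ] j) ⇔ (j ∈ lookup (neighbourhoods G) i)
  ∈-neighbourhoods G i j = mk⇔
    (λ a → lookup⇒[]= j _ (trans eq (dec-true (Graph._~?_ G i j) a)))
    (λ m → does⇒ (Graph._~?_ G i j) (trans (sym eq) ([]=⇒lookup m)))
    where
    eq : lookup (lookup (neighbourhoods G) i) j ≡ does (Graph._~?_ G i j)
    eq = trans (cong (λ r → lookup r j) (lookup∘tabulate _ i)) (lookup∘tabulate _ j)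

    does⇒ : {P : Set} (p? : Dec P) → does p? ≡ true → P
    does⇒ (yes p) _ = p

  fromNeighbourhoods-complete : (G : Graph n) → Maybe.Any (G ≈_) (fromNeighbourhoods (neighbourhoods G))
  fromNeighbourhoods-complete G
    with (Fin.all? λ i → Fin.all? λ j → (j ∈? lookup (neighbourhoods G) i) →-dec (i ∈? lookup (neighbourhoods G) j))
       | (Fin.all? λ i → ¬? (i ∈? lookup (neighbourhoods G) i))
  ... | yes _ | yes _ = Maybe.just (∈-neighbourhoods G)
  ... | yes _ | no ¬r = ⊥-elim (¬r λ i → Graph.~-irr G i ∘ from (∈-neighbourhoods G i i))
  ... | no ¬s | _     = ⊥-elim (¬s λ i j → to (∈-neighbourhoods G j i) ∘ Graph.~-sym G ∘ from (∈-neighbourhoods G i j))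

graphs-complete : (G : Graph n) → Any (G ≈_) (graphs n)
graphs-complete G = Any.mapMaybe⁺ fromNeighbourhoods _
  (Any.map⁺ (Any.map (λ { refl → fromNeighbourhoods-complete G })
                     (vecs-complete subsets-complete (neighbourhoods G))))

private
  induces-≈ : (A : Graph k) {G H : Graph n} → G ≈ H → ∀ {S} → Induces A G S → Induces A H S
  induces-≈ A G≈H (φ , c) = φ , record
    { injective = injective
    ; image     = image
    ; adjacency = λ i j → mk⇔ (to (G≈H _ _) ∘ to (adjacency i j)) (from (adjacency i j) ∘ from (G≈H _ _))
    }
    where open IsInducedCopy c

  ≈-sym : {G H : Graph n} → G ≈ H → H ≈ G
  ≈-sym G≈H i j = mk⇔ (from (G≈H i j)) (to (G≈H i j))

  ⊑-≈ : {K : Graph k} {G H : Graph n} → G ≈ H → K ⊑ G → K ⊑ H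
  ⊑-≈ G≈H (φ , e) = φ , record
    { injective = injective
    ; adjacency = λ i j → to (G≈H _ _) ∘ adjacency i j
    }
    where open IsEmbedding e

#copies-≈ : (A : Graph k) {G H : Graph n} → G ≈ H → #copies A G ≡ #copies A H
#copies-≈ {n = n} A {G} {H} G≈H = cong length (filter-≐ _ _
  ( (λ (c , i) → c , induces-≈ A {G} {H} G≈H i)
  , (λ (c , i) → c , induces-≈ A {H} {G} (≈-sym {G = G} {H} G≈H) i)) (subsets n))

free-≈ : (F : Family) {G H : Graph n} → G ≈ H → Free F G → Free F H
free-≈ F {G} {H} G≈H = All.map λ ¬K⊑G → ¬K⊑G ∘ ⊑-≈ {G = H} {G} (≈-sym {G = G} {H} G≈H)

ex-upper : (A : Graph k) (F : Family) (G : Graph n) → Free F G → #copies A G ℕ.≤ ex A F n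
ex-upper {n = n} A F G free with List.find (graphs-complete G)
... | H , H∈ , G≈H = subst (ℕ._≤ ex A F n) (sym (#copies-≈ A {G} {H} G≈H))
  (All.lookup (xs≤max 0 _) (∈-map⁺ (#copies A) (∈-filter⁺ (free? F) H∈ (free-≈ F {G} {H} G≈H free))))

ex-attained : (A : Graph k) (F : Family) → ∃ (Free {n} F) →
              Σ (Graph n) λ G → Free F G × #copies A G ≡ ex A F n
ex-attained {n = n} A F (G , free)
  with argmax-sel (λ x → x) 0 (map (#copies A) (filter (free? F) (graphs n)))
... | inj₁ ex≡0 = G , free , trans (ℕ.n≤0⇒n≡0 (subst (#copies A G ℕ.≤_) ex≡0 (ex-upper A F G free))) (sym ex≡0)
... | inj₂ ex∈ with ∈-map⁻ (#copies A) ex∈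
...   | H , H∈ , eq = H , proj₂ (∈-filter⁻ (free? F) {xs = graphs n} H∈) , sym eq

-- Cauchy sequences of rationals, not quotiented.
record ℝ : Set where
  field
    seq    : ℕ → ℚ
    cauchy : ∀ ε → 0ℚ ℚ.< ε → ∃ λ N → ∀ m n → N ℕ.≤ m → N ℕ.≤ n → ℚ.∣ seq m ℚ.- seq n ∣ ℚ.≤ ε

open ℝ

infix 4 _≤_
_≤_ : ℝ → ℝ → Set
x ≤ y = ∀ ε → 0ℚ ℚ.< ε → ∃ λ N → ∀ n → N ℕ.≤ n → seq x n ℚ.≤ seq y n ℚ.+ ε

fromℚ : ℚ → ℝ
fromℚ q = record
  { seq    = λ _ → q
  ; cauchy = λ ε 0<ε → 0 , λ _ _ _ _ → subst (λ z → ℚ.∣ z ∣ ℚ.≤ ε) (sym (ℚ.+-inverseʳ q)) (ℚ.<⇒≤ 0<ε)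
  }

private
  half : ∀ {ε} → 0ℚ ℚ.< ε → 0ℚ ℚ.< ½ ℚ.* ε
  half {ε} = ℚ.*-monoʳ-<-pos ½

  halves : ∀ ε → ½ ℚ.* ε ℚ.+ ½ ℚ.* ε ≡ ε
  halves ε = trans (sym (ℚ.*-distribʳ-+ ε ½ ½)) (ℚ.*-identityˡ ε)

  interchange : ∀ a b c d → (a ℚ.- b) ℚ.- (c ℚ.- d) ≡ (a ℚ.- c) ℚ.- (b ℚ.- d)
  interchange = solve 4 (λ a b c d → (a :- b) :- (c :- d) := (a :- c) :- (b :- d)) refl
    where open +-*-Solver

  x≡[x-y]+y : ∀ x y → x ≡ (x ℚ.- y) ℚ.+ y
  x≡[x-y]+y = solve 2 (λ x y → x := (x :- y) :+ y) refl
    where open +-*-Solver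

  [x+y]-y≡x : ∀ x y → (x ℚ.+ y) ℚ.- y ≡ x
  [x+y]-y≡x = solve 2 (λ x y → (x :+ y) :- y := x) refl
    where open +-*-Solver

  -[x-y]≡y-x : ∀ x y → ℚ.- (x ℚ.- y) ≡ y ℚ.- x
  -[x-y]≡y-x = solve 2 (λ x y → :- (x :- y) := y :- x) refl
    where open +-*-Solver

  ∣x∣-∣y∣≤∣x-y∣ : ∀ x y → ℚ.∣ x ∣ ℚ.- ℚ.∣ y ∣ ℚ.≤ ℚ.∣ x ℚ.- y ∣
  ∣x∣-∣y∣≤∣x-y∣ x y = begin
    ℚ.∣ x ∣ ℚ.- ℚ.∣ y ∣                            ≡⟨ cong (λ z → ℚ.∣ z ∣ ℚ.- ℚ.∣ y ∣) (x≡[x-y]+y x y) ⟩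
    ℚ.∣ (x ℚ.- y) ℚ.+ y ∣ ℚ.- ℚ.∣ y ∣              ≤⟨ ℚ.+-monoˡ-≤ (ℚ.- ℚ.∣ y ∣) (ℚ.∣p+q∣≤∣p∣+∣q∣ (x ℚ.- y) y) ⟩
    (ℚ.∣ x ℚ.- y ∣ ℚ.+ ℚ.∣ y ∣) ℚ.- ℚ.∣ y ∣        ≡⟨ [x+y]-y≡x ℚ.∣ x ℚ.- y ∣ ℚ.∣ y ∣ ⟩
    ℚ.∣ x ℚ.- y ∣                                  ∎
    where open ℚ.≤-Reasoning

  ∣∣x∣-∣y∣∣≤∣x-y∣ : ∀ x y → ℚ.∣ ℚ.∣ x ∣ ℚ.- ℚ.∣ y ∣ ∣ ℚ.≤ ℚ.∣ x ℚ.- y ∣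
  ∣∣x∣-∣y∣∣≤∣x-y∣ x y with ℚ.∣p∣≡p∨∣p∣≡-p (ℚ.∣ x ∣ ℚ.- ℚ.∣ y ∣)
  ... | inj₁ eq = subst (ℚ._≤ ℚ.∣ x ℚ.- y ∣) (sym eq) (∣x∣-∣y∣≤∣x-y∣ x y)
  ... | inj₂ eq = begin
    ℚ.∣ ℚ.∣ x ∣ ℚ.- ℚ.∣ y ∣ ∣  ≡⟨ trans eq (-[x-y]≡y-x ℚ.∣ x ∣ ℚ.∣ y ∣) ⟩
    ℚ.∣ y ∣ ℚ.- ℚ.∣ x ∣        ≤⟨ ∣x∣-∣y∣≤∣x-y∣ y x ⟩
    ℚ.∣ y ℚ.- x ∣              ≡⟨ cong ℚ.∣_∣ (-[x-y]≡y-x x y) ⟨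
    ℚ.∣ ℚ.- (x ℚ.- y) ∣        ≡⟨ ℚ.∣-p∣≡∣p∣ (x ℚ.- y) ⟩
    ℚ.∣ x ℚ.- y ∣              ∎
    where open ℚ.≤-Reasoning

infixl 6 _-_
_-_ : ℝ → ℝ → ℝ
seq    (x - y) n     = seq x n ℚ.- seq y n
cauchy (x - y) ε 0<ε with cauchy x (½ ℚ.* ε) (half 0<ε) | cauchy y (½ ℚ.* ε) (half 0<ε)
... | M , p | N , q = M ℕ.⊔ N , λ m n ≤m ≤n → begin
  ℚ.∣ (seq x m ℚ.- seq y m) ℚ.- (seq x n ℚ.- seq y n) ∣
    ≡⟨ cong ℚ.∣_∣ (interchange (seq x m) (seq y m) (seq x n) (seq y n)) ⟩
  ℚ.∣ (seq x m ℚ.- seq x n) ℚ.- (seq y m ℚ.- seq y n) ∣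
    ≤⟨ ℚ.∣p-q∣≤∣p∣+∣q∣ (seq x m ℚ.- seq x n) (seq y m ℚ.- seq y n) ⟩
  ℚ.∣ seq x m ℚ.- seq x n ∣ ℚ.+ ℚ.∣ seq y m ℚ.- seq y n ∣
    ≤⟨ ℚ.+-mono-≤ (p m n (ℕ.m⊔n≤o⇒m≤o M N ≤m) (ℕ.m⊔n≤o⇒m≤o M N ≤n))
                  (q m n (ℕ.m⊔n≤o⇒n≤o M N ≤m) (ℕ.m⊔n≤o⇒n≤o M N ≤n)) ⟩
  ½ ℚ.* ε ℚ.+ ½ ℚ.* ε
    ≡⟨ halves ε ⟩
  ε ∎
  where open ℚ.≤-Reasoning

abs : ℝ → ℝ
seq    (abs x) n     = ℚ.∣ seq x n ∣
cauchy (abs x) ε 0<ε with cauchy x ε 0<ε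
... | N , p = N , λ m n ≤m ≤n → ℚ.≤-trans (∣∣x∣-∣y∣∣≤∣x-y∣ (seq x m) (seq x n)) (p m n ≤m ≤n)

infix 4 _⟶_
_⟶_ : (ℕ → ℝ) → ℝ → Set
a ⟶ L = ∀ ε → 0ℚ ℚ.< ε → ∃ λ N → ∀ n → N ℕ.≤ n → abs (a n - L) ≤ fromℚ ε

-- The junk value at denominator 0 occurs below only for n < k, which
-- does not affect the limit.
ratio : ℕ → ℕ → ℚ
ratio m zero        = 0ℚ
ratio m d@(suc _)   = + m ℚ./ d

-- L = π_A(F).
IsTuránDensity : Graph k → Family → ℝ → Set
IsTuránDensity {k} A F L = (λ n → fromℚ (ratio (ex A F n) (n C k))) ⟶ L

module Submission where

-- Sampling five vertices of a triangle-free graph G with repetition, the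
-- induced pattern on the five labels is again triangle-free, so an inequality
-- between local functions of such patterns yields an inequality for G without
-- error terms. The certificate adds to the pentagon indicator weighted products
-- g(x₁x₂x₃; x₄) g(x₁x₂x₃; x₅); their sum over x₄ and x₅ is a square, hence
-- nonnegative. Symmetrised over S₅, the certificate is bounded on each of the
-- finitely many triangle-free patterns by a constant that gives at most
-- 10 (n/5)⁵ labelled pentagons. Each induced C₅ has ten labellings, so G has at
-- most (n/5)⁵ copies of C₅, and (n/5)⁵ is asymptotic to 24/625 · (n C 5).

open import Defs
open import Data.Bool.Base using (Bool; true; false; T; not; _∧_; _∨_; if_then_else_)
open import Data.Bool.Properties using (T-∧)
open import Data.Empty using (⊥; ⊥-elim)
open import Data.Fin.Base using (Fin; zero; suc)
open import Data.Fin.Patterns using (0F; 1F; 2F; 3F; 4F)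
import Data.Fin.Properties as Fin
open import Data.Fin.Subset using (Subset; _∈_; ∣_∣)
open import Data.Fin.Subset.Properties using (⊆-antisym)
open import Data.Integer.Base as ℤ using (ℤ; +_; -_; _+_; _*_; 0ℤ; 1ℤ)
import Data.Integer.Properties as ℤ
open import Data.List.Base using (List; []; _∷_; _++_; length; map)
import Data.List.Membership.Propositional as List
import Data.List.Properties as List
open import Data.List.Relation.Unary.All as All using (All; []; _∷_)
import Data.List.Relation.Unary.All.Properties as All
open import Data.List.Relation.Unary.AllPairs using ([]; _∷_)
open import Data.List.Relation.Unary.Any as Any using (Any)
open import Data.List.Relation.Unary.Unique.DecPropositional using (unique?)
open import Data.List.Relation.Unary.Unique.Propositional using (Unique)
import Data.List.Relation.Unary.Unique.Propositional.Properties as Unique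
open import Data.Nat.Base as ℕ using (ℕ; zero; suc; _^_; _!)
open import Data.Nat.Combinatorics using (_C_; nCk+nC[k+1]≡[n+1]C[k+1])
import Data.Nat.Properties as ℕ
import Data.Nat.Solver as ℕ-Solver
open import Data.Product.Base using (∃; _×_; _,_; proj₁; proj₂)
open import Data.Rational.Base as ℚ using (ℚ; mkℚ; 0ℚ; _/_)
import Data.Rational.Properties as ℚ
import Data.Rational.Solver as ℚ-Solver
import Data.Rational.Unnormalised.Base as ℚᵘ
import Data.Rational.Unnormalised.Properties as ℚᵘ
open import Data.Sum.Base using (inj₁; inj₂)
open import Data.Vec.Base as Vec using (Vec; []; _∷_; lookup)
import Data.Vec.Properties as Vec
open import Function.Base using (_∘_)
open import Function.Bundles using (_⇔_; mk⇔; module Equivalence)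
open import Relation.Binary.Definitions using (DecidableEquality)
open import Relation.Binary.PropositionalEquality using (_≡_; _≢_; refl; sym; trans; cong; cong₂; subst; subst₂; module ≡-Reasoning)
open import Relation.Nullary using (¬_; Dec; does; yes; no)
open import Relation.Nullary.Decidable using (does-⇔; from-yes; _×-dec_)

open import Algebra.Properties.Semiring.Sum ℤ.+-*-semiring using (sum; sum-cong-≗; ∑-distrib-+; ∑-comm; *-distribˡ-sum; *-distribʳ-sum)
open Equivalence using (to; from)

private
  variable
    k n : ℕ
    A : Set

-- Patterns on five vertices and the flag algebra certificate

-- The adjacencies 12, 13, 14, 15, 23, 24, 25, 34, 35, 45 of five vertices.
Pattern : Set
Pattern = Vec Bool 10

isTriangle : (x y z : Bool) → Bool
isTriangle true true true = true
isTriangle _    _    _    = false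

triangleFree : Pattern → Bool
triangleFree (a ∷ b ∷ c ∷ d ∷ e ∷ f ∷ g ∷ h ∷ i ∷ j ∷ []) =
  not (isTriangle a b e) ∧ not (isTriangle a c f) ∧ not (isTriangle a d g) ∧
  not (isTriangle b c h) ∧ not (isTriangle b d i) ∧ not (isTriangle c d j) ∧
  not (isTriangle e f h) ∧ not (isTriangle e g i) ∧ not (isTriangle f g j) ∧
  not (isTriangle h i j)

-- Tests the five edges of the cycle 12345 only: in a triangle-free pattern every chord is absent,
-- since it would close a triangle with two of these edges.
pentagon : Pattern → ℤ
pentagon (true ∷ _ ∷ _ ∷ true ∷ true ∷ _ ∷ _ ∷ true ∷ _ ∷ true ∷ []) = 1ℤ
pentagon _                                                           = 0ℤ

-- The action of adjacent transpositions on the adjacencies; `0F` exchanges vertices 1 and 2, and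
-- `3F` exchanges 4 and 5.
swapPattern : Fin 4 → Pattern → Pattern
swapPattern 0F (a ∷ b ∷ c ∷ d ∷ e ∷ f ∷ g ∷ h ∷ i ∷ j ∷ []) = a ∷ e ∷ f ∷ g ∷ b ∷ c ∷ d ∷ h ∷ i ∷ j ∷ []
swapPattern 1F (a ∷ b ∷ c ∷ d ∷ e ∷ f ∷ g ∷ h ∷ i ∷ j ∷ []) = b ∷ a ∷ c ∷ d ∷ e ∷ h ∷ i ∷ f ∷ g ∷ j ∷ []
swapPattern 2F (a ∷ b ∷ c ∷ d ∷ e ∷ f ∷ g ∷ h ∷ i ∷ j ∷ []) = a ∷ c ∷ b ∷ d ∷ f ∷ e ∷ g ∷ h ∷ j ∷ i ∷ []
swapPattern 3F (a ∷ b ∷ c ∷ d ∷ e ∷ f ∷ g ∷ h ∷ i ∷ j ∷ []) = a ∷ b ∷ d ∷ c ∷ e ∷ g ∷ f ∷ i ∷ h ∷ j ∷ []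

sumAlong : List (Fin 4) → (Pattern → ℤ) → Pattern → ℤ
sumAlong []       φ p = φ p
sumAlong (i ∷ is) φ p = φ p + sumAlong is φ (swapPattern i p)

-- The partial products of the k-th chain of swaps are coset representatives of
-- Sₖ in Sₖ₊₁, so every permutation of the five vertices occurs exactly once.
symmetrise : (Pattern → ℤ) → Pattern → ℤ
symmetrise = sumAlong (0F ∷ []) ∘ sumAlong (1F ∷ 0F ∷ []) ∘ sumAlong (2F ∷ 1F ∷ 0F ∷ [])
           ∘ sumAlong (3F ∷ 2F ∷ 1F ∷ 0F ∷ [])

-- A function of the adjacencies of one vertex to three fixed vertices.
Form : Set
Form = (x y z : Bool) → ℤ

bySize : (c₀ c₁ c₂ c₃ : ℤ) → Form
bySize c₀ c₁ c₂ c₃ false false false = c₀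
bySize c₀ c₁ c₂ c₃ true  false false = c₁
bySize c₀ c₁ c₂ c₃ false true  false = c₁
bySize c₀ c₁ c₂ c₃ false false true  = c₁
bySize c₀ c₁ c₂ c₃ true  true  false = c₂
bySize c₀ c₁ c₂ c₃ true  false true  = c₂
bySize c₀ c₁ c₂ c₃ false true  true  = c₂
bySize c₀ c₁ c₂ c₃ true  true  true  = c₃

-- For fixed vertices 1 and 2 that are adjacent; the junk value 0 is assigned
-- to the neighbourhoods that would create a triangle.
bySubset : (c₀ c₁ c₂ c₃ c₁₃ c₂₃ : ℤ) → Form
bySubset c₀ c₁ c₂ c₃ c₁₃ c₂₃ false false false = c₀
bySubset c₀ c₁ c₂ c₃ c₁₃ c₂₃ true  false false = c₁
bySubset c₀ c₁ c₂ c₃ c₁₃ c₂₃ false true  false = c₂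
bySubset c₀ c₁ c₂ c₃ c₁₃ c₂₃ false false true  = c₃
bySubset c₀ c₁ c₂ c₃ c₁₃ c₂₃ true  false true  = c₁₃
bySubset c₀ c₁ c₂ c₃ c₁₃ c₂₃ false true  true  = c₂₃
bySubset c₀ c₁ c₂ c₃ c₁₃ c₂₃ true  true  _     = 0ℤ

-- The weighted squares for each graph induced on the three fixed vertices,
-- given by its adjacencies 12, 13, 23. They form an exact rational solution of
-- the flag algebra semidefinite program; every form has sum 0 on each balanced
-- blow-up of C₅, where the bound is tight.
squares : (x y z : Bool) → List (ℕ × Form)
squares false false false =
    (39    , bySize (+ 4) (- + 7) (+ 5) (- + 6))
  ∷ (2457  , bySize (+ 0) (- + 1) (+ 1) (+ 0))
  ∷ []
squares true false false =
    (18    , bySubset (- + 26) (+ 17) (+ 17) (+ 31) (- + 4) (- + 4))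
  ∷ (6810  , bySubset (+ 0) (+ 1) (+ 1) (- + 2) (- + 1) (- + 1))
  ∷ (58500 , bySubset (+ 0) (+ 0) (+ 0) (+ 0) (+ 1) (- + 1))
  ∷ []
squares true false true =
    (559   , bySubset (- + 8) (- + 3) (+ 2) (- + 3) (+ 2) (+ 0))
  ∷ (468   , bySubset (+ 0) (- + 1) (+ 2) (- + 1) (- + 2) (+ 0))
  ∷ (884   , bySubset (- + 2) (+ 0) (- + 1) (+ 0) (+ 2) (+ 0))
  ∷ (47853 , bySubset (+ 0) (+ 1) (+ 0) (- + 1) (+ 0) (+ 0))
  ∷ []
squares _ _ _ = []

products : List (ℕ × Form) → (x y z x′ y′ z′ : Bool) → ℤ
products []             x y z x′ y′ z′ = 0ℤ
products ((w , φ) ∷ ss) x y z x′ y′ z′ = + w * (φ x y z * φ x′ y′ z′) + products ss x y z x′ y′ z′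

-- The graph on vertices 1, 2, 3 selects the squares. Vertices 4 and 5 enter only through their
-- adjacencies to these three, so the sum over 4 and 5 factors. `squares` treats one labelling each
-- of the edgeless graph, the single edge and the path; `symmetrise` supplies the other labellings.
flags : Pattern → ℤ
flags (a ∷ b ∷ c ∷ d ∷ e ∷ f ∷ g ∷ h ∷ i ∷ j ∷ []) = products (squares a b e) c f h d g i

certificate : ℤ → Pattern → ℤ
certificate c p = c * pentagon p + flags p

-- Evaluation of the certificate on all patterns

everywhere : ∀ n → (Vec Bool n → Bool) → Bool
everywhere zero    P = P []
everywhere (suc n) P = everywhere n (P ∘ (false ∷_)) ∧ everywhere n (P ∘ (true ∷_))

everywhere-sound : ∀ {n} (P : Vec Bool n → Bool) → T (everywhere n P) → ∀ v → T (P v)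
everywhere-sound P t []          = t
everywhere-sound P t (false ∷ v) = everywhere-sound (P ∘ (false ∷_)) (proj₁ (to T-∧ t)) v
everywhere-sound P t (true  ∷ v) = everywhere-sound (P ∘ (true ∷_)) (proj₂ (to T-∧ t)) v

withinBound : Pattern → Bool
withinBound p = not (triangleFree p) ∨ (symmetrise (certificate (+ 195000)) p ℤ.≤ᵇ + 74880)

abstract
  -- By evaluation on all 1024 patterns, after which the type is the unit type.
  all-withinBound : T (everywhere 10 withinBound)
  all-withinBound = _

T-modus-ponens : ∀ {x y} → T (not x ∨ y) → T x → T y
T-modus-ponens {x = true} t _ = t

-- The constant is 120 · 624, one term for each permutation, and 624/195000 = 10/3125 is the
-- proportion of 5-tuples that are labelled pentagons in a balanced blow-up of `C₅`.
certificate-bound : ∀ p → T (triangleFree p) → symmetrise (certificate (+ 195000)) p ℤ.≤ + 74880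
certificate-bound p free =
  ℤ.≤ᵇ⇒≤ (T-modus-ponens {x = triangleFree p} (everywhere-sound withinBound all-withinBound p) free)

-- Sums over tuples of vertices

swap : Fin k → Vec A (suc k) → Vec A (suc k)
swap zero    (x ∷ y ∷ v) = y ∷ x ∷ v
swap (suc i) (x ∷ v)     = x ∷ swap i v

sum-mono : {f g : Fin n → ℤ} → (∀ i → f i ℤ.≤ g i) → sum f ℤ.≤ sum g
sum-mono {n = zero}  f≤g = ℤ.≤-refl
sum-mono {n = suc _} f≤g = ℤ.+-mono-≤ (f≤g zero) (sum-mono (f≤g ∘ suc))

sum-const : ∀ n c → sum {n} (λ _ → c) ≡ + n * c
sum-const zero    c = sym (ℤ.*-zeroˡ c)
sum-const (suc n) c = trans (cong (λ s → c + s) (sum-const n c)) (sym (ℤ.suc-* (+ n) c))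

sum-nonNeg : {f : Fin n → ℤ} → (∀ i → 0ℤ ℤ.≤ f i) → 0ℤ ℤ.≤ sum f
sum-nonNeg {n = zero}  0≤f = ℤ.≤-refl
sum-nonNeg {n = suc _} 0≤f = ℤ.+-mono-≤ (0≤f zero) (sum-nonNeg (0≤f ∘ suc))

term≤sum : {f : Fin n → ℤ} → (∀ i → 0ℤ ℤ.≤ f i) → ∀ i → f i ℤ.≤ sum f
term≤sum {f = f} 0≤f zero    = subst (ℤ._≤ sum f) (ℤ.+-identityʳ (f zero))
  (ℤ.+-monoʳ-≤ (f zero) (sum-nonNeg (0≤f ∘ suc)))
term≤sum {f = f} 0≤f (suc i) = subst (ℤ._≤ sum f) (ℤ.+-identityˡ (f (suc i)))
  (ℤ.+-mono-≤ (0≤f zero) (term≤sum (0≤f ∘ suc) i))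

sumVec : (Vec (Fin n) k → ℤ) → ℤ
sumVec {k = zero}  f = f []
sumVec {k = suc _} f = sum λ i → sumVec λ v → f (i ∷ v)

sumVec-cong : {f g : Vec (Fin n) k → ℤ} → (∀ v → f v ≡ g v) → sumVec f ≡ sumVec g
sumVec-cong {k = zero}  f≡g = f≡g []
sumVec-cong {k = suc _} f≡g = sum-cong-≗ λ i → sumVec-cong λ v → f≡g (i ∷ v)

sumVec-mono : {f g : Vec (Fin n) k → ℤ} → (∀ v → f v ℤ.≤ g v) → sumVec f ℤ.≤ sumVec g
sumVec-mono {k = zero}  f≤g = f≤g []
sumVec-mono {k = suc _} f≤g = sum-mono λ i → sumVec-mono λ v → f≤g (i ∷ v)

sumVec-nonNeg : {f : Vec (Fin n) k → ℤ} → (∀ v → 0ℤ ℤ.≤ f v) → 0ℤ ℤ.≤ sumVec f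
sumVec-nonNeg {k = zero}  0≤f = 0≤f []
sumVec-nonNeg {k = suc _} 0≤f = sum-nonNeg λ i → sumVec-nonNeg λ v → 0≤f (i ∷ v)

term≤sumVec : {f : Vec (Fin n) k → ℤ} → (∀ v → 0ℤ ℤ.≤ f v) → ∀ v → f v ℤ.≤ sumVec f
term≤sumVec 0≤f []      = ℤ.≤-refl
term≤sumVec 0≤f (i ∷ v) = ℤ.≤-trans (term≤sumVec (0≤f ∘ (i ∷_)) v)
  (term≤sum (λ j → sumVec-nonNeg (0≤f ∘ (j ∷_))) i)

sumVec-+ : (f g : Vec (Fin n) k → ℤ) → sumVec (λ v → f v + g v) ≡ sumVec f + sumVec g
sumVec-+ {k = zero}  f g = refl
sumVec-+ {k = suc _} f g = trans
  (sum-cong-≗ λ i → sumVec-+ (f ∘ (i ∷_)) (g ∘ (i ∷_)))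
  (∑-distrib-+ (λ i → sumVec (f ∘ (i ∷_))) (λ i → sumVec (g ∘ (i ∷_))))

sumVec-*ˡ : (c : ℤ) (f : Vec (Fin n) k → ℤ) → sumVec (λ v → c * f v) ≡ c * sumVec f
sumVec-*ˡ {k = zero}  c f = refl
sumVec-*ˡ {k = suc _} c f = trans
  (sum-cong-≗ λ i → sumVec-*ˡ c (f ∘ (i ∷_)))
  (sym (*-distribˡ-sum c (λ i → sumVec (f ∘ (i ∷_)))))

sumVec-const : ∀ n k c → sumVec {n} {k} (λ _ → c) ≡ + (n ℕ.^ k) * c
sumVec-const n zero    c = sym (ℤ.*-identityˡ c)
sumVec-const n (suc k) c = begin
  sum {n} (λ _ → sumVec {n} {k} (λ _ → c))  ≡⟨ sum-const n _ ⟩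
  + n * sumVec {n} {k} (λ _ → c)            ≡⟨ cong (λ s → + n * s) (sumVec-const n k c) ⟩
  + n * (+ (n ℕ.^ k) * c)                   ≡⟨ ℤ.*-assoc (+ n) (+ (n ℕ.^ k)) c ⟨
  + n * + (n ℕ.^ k) * c                     ≡⟨ cong (_* c) (ℤ.pos-* n (n ℕ.^ k)) ⟨
  + (n ℕ.^ suc k) * c                       ∎
  where open ≡-Reasoning

-- A single interchange of two neighbouring summation signs.
sumVec-swap : (i : Fin k) (f : Vec (Fin n) (suc k) → ℤ) → sumVec (f ∘ swap i) ≡ sumVec f
sumVec-swap zero    f = ∑-comm λ i j → sumVec λ v → f (j ∷ i ∷ v)
sumVec-swap (suc i) f = sum-cong-≗ λ x → sumVec-swap i (f ∘ (x ∷_))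

square-nonNeg : ∀ i → 0ℤ ℤ.≤ i * i
square-nonNeg (+ n)        = subst (0ℤ ℤ.≤_) (ℤ.pos-* n n) (ℤ.+≤+ ℕ.z≤n)
square-nonNeg (ℤ.-[1+ n ]) = ℤ.+≤+ ℕ.z≤n

-- A form with values `s i` and weight `w` contributes `w` times the square of `sum s`.
products-nonNeg : ∀ ss (x y z : Fin n → Bool) →
                  0ℤ ℤ.≤ sum λ i → sum λ j → products ss (x i) (y i) (z i) (x j) (y j) (z j)
products-nonNeg {n = n} []     x y z = sum-nonNeg {n = n} λ _ → sum-nonNeg {n = n} λ _ → ℤ.≤-refl
products-nonNeg {n = n} ((w , φ) ∷ ss) x y z = subst (0ℤ ℤ.≤_) (sym split)
  (ℤ.+-mono-≤ {0ℤ} {_} {0ℤ} weighted (products-nonNeg ss x y z))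
  where
  open ≡-Reasoning
  s : Fin n → ℤ
  s i = φ (x i) (y i) (z i)

  rest : Fin n → Fin n → ℤ
  rest i j = products ss (x i) (y i) (z i) (x j) (y j) (z j)

  weighted : 0ℤ ℤ.≤ + w * (sum s * sum s)
  weighted = subst (ℤ._≤ + w * (sum s * sum s)) (ℤ.*-zeroʳ (+ w))
    (ℤ.*-monoˡ-≤-nonNeg (+ w) (square-nonNeg (sum s)))

  split : (sum λ i → sum λ j → + w * (s i * s j) + rest i j) ≡
          + w * (sum s * sum s) + (sum λ i → sum (rest i))
  split = begin
    (sum λ i → sum λ j → + w * (s i * s j) + rest i j)
      ≡⟨ sum-cong-≗ (λ i → ∑-distrib-+ (λ j → + w * (s i * s j)) (rest i)) ⟩
    (sum λ i → (sum λ j → + w * (s i * s j)) + sum (rest i))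
      ≡⟨ ∑-distrib-+ (λ i → sum λ j → + w * (s i * s j)) (λ i → sum (rest i)) ⟩
    (sum λ i → sum λ j → + w * (s i * s j)) + (sum λ i → sum (rest i))
      ≡⟨ cong (_+ (sum λ i → sum (rest i))) square ⟩
    + w * (sum s * sum s) + (sum λ i → sum (rest i)) ∎
    where
    square : (sum λ i → sum λ j → + w * (s i * s j)) ≡ + w * (sum s * sum s)
    square = begin
      (sum λ i → sum λ j → + w * (s i * s j))
        ≡⟨ sum-cong-≗ (λ i → sym (*-distribˡ-sum (+ w) (λ j → s i * s j))) ⟩
      (sum λ i → + w * (sum λ j → s i * s j))
        ≡⟨ *-distribˡ-sum (+ w) (λ i → sum λ j → s i * s j) ⟨
      + w * (sum λ i → sum λ j → s i * s j)
        ≡⟨ cong (λ s → + w * s) (sum-cong-≗ λ i → sym (*-distribˡ-sum (s i) s)) ⟩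
      + w * (sum λ i → s i * sum s)
        ≡⟨ cong (λ s → + w * s) (*-distribʳ-sum (sum s) s) ⟨
      + w * (sum s * sum s) ∎

*-assoc-≡ : ∀ a b {c} x → a * b ≡ c → a * (b * x) ≡ c * x
*-assoc-≡ a b x ab≡c = trans (sym (ℤ.*-assoc a b x)) (cong (_* x) ab≡c)

-- Stated for variables because converting a product of a large literal and an
-- open term would unfold the literal in unary.
*-cancel-scaled-≤ : ∀ a b c d e k x y .{{_ : ℤ.Positive k}} → a * b ≡ k * d → c ≡ k * e →
                    a * (b * x) ℤ.≤ y * c → d * x ℤ.≤ e * y
*-cancel-scaled-≤ a b c d e k x y ab≡kd c≡ke abx≤yc = ℤ.*-cancelˡ-≤-pos (d * x) (e * y) k (begin
  k * (d * x)  ≡⟨ ℤ.*-assoc k d x ⟨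
  k * d * x    ≡⟨ *-assoc-≡ a b x ab≡kd ⟨
  a * (b * x)  ≤⟨ abx≤yc ⟩
  y * c        ≡⟨ ℤ.*-comm y c ⟩
  c * y        ≡⟨ *-assoc-≡ k e y (sym c≡ke) ⟨
  k * (e * y)  ∎)
  where open ℤ.≤-Reasoning

-- Patterns of vertex tuples in a graph

adjacent : Graph n → Fin n → Fin n → Bool
adjacent G i j = does (Graph._~?_ G i j)

adjacent-sym : (G : Graph n) → ∀ i j → adjacent G i j ≡ adjacent G j i
adjacent-sym G i j = does-⇔ (mk⇔ (Graph.~-sym G) (Graph.~-sym G)) (Graph._~?_ G i j) (Graph._~?_ G j i)

pattern-of : Graph n → Vec (Fin n) 5 → Pattern
pattern-of G (u ∷ v ∷ w ∷ x ∷ y ∷ []) =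
  u ∙ v ∷ u ∙ w ∷ u ∙ x ∷ u ∙ y ∷ v ∙ w ∷ v ∙ x ∷ v ∙ y ∷ w ∙ x ∷ w ∙ y ∷ x ∙ y ∷ []
  where _∙_ = adjacent G

pattern-of-swap : (G : Graph n) → ∀ i v → pattern-of G (swap i v) ≡ swapPattern i (pattern-of G v)
pattern-of-swap G 0F (u ∷ v ∷ w ∷ x ∷ y ∷ []) rewrite adjacent-sym G u v = refl
pattern-of-swap G 1F (u ∷ v ∷ w ∷ x ∷ y ∷ []) rewrite adjacent-sym G v w = refl
pattern-of-swap G 2F (u ∷ v ∷ w ∷ x ∷ y ∷ []) rewrite adjacent-sym G w x = refl
pattern-of-swap G 3F (u ∷ v ∷ w ∷ x ∷ y ∷ []) rewrite adjacent-sym G x y = refl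

-- Swapping entries of the tuple permutes the summation range, so all `suc (length is)` summands
-- have the same total.
sumVec-sumAlong : (G : Graph n) → ∀ is φ → sumVec (sumAlong is φ ∘ pattern-of G) ≡
                  + suc (length is) * sumVec (φ ∘ pattern-of G)
sumVec-sumAlong G []       φ = sym (ℤ.*-identityˡ _)
sumVec-sumAlong G (i ∷ is) φ = begin
  sumVec (λ v → φ (pattern-of G v) + sumAlong is φ (swapPattern i (pattern-of G v)))
    ≡⟨ sumVec-cong (λ v → cong (λ p → φ (pattern-of G v) + sumAlong is φ p) (sym (pattern-of-swap G i v))) ⟩
  sumVec (λ v → φ (pattern-of G v) + sumAlong is φ (pattern-of G (swap i v)))
    ≡⟨ sumVec-+ (φ ∘ pattern-of G) (sumAlong is φ ∘ pattern-of G ∘ swap i) ⟩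
  total + sumVec (sumAlong is φ ∘ pattern-of G ∘ swap i)
    ≡⟨ cong (λ s → total + s) (sumVec-swap i (sumAlong is φ ∘ pattern-of G)) ⟩
  total + sumVec (sumAlong is φ ∘ pattern-of G)
    ≡⟨ cong (λ s → total + s) (sumVec-sumAlong G is φ) ⟩
  total + + suc (length is) * total
    ≡⟨ ℤ.suc-* (+ suc (length is)) total ⟨
  + suc (suc (length is)) * total ∎
  where
  open ≡-Reasoning
  total : ℤ
  total = sumVec (φ ∘ pattern-of G)

sumVec-symmetrise : (G : Graph n) → ∀ φ → sumVec (symmetrise φ ∘ pattern-of G) ≡ + 120 * sumVec (φ ∘ pattern-of G)
sumVec-symmetrise G φ = begin
  sumVec (sumAlong w₂ φ₃ ∘ pattern-of G)                ≡⟨ sumVec-sumAlong G w₂ φ₃ ⟩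
  + 2 * sumVec (sumAlong w₃ φ₄ ∘ pattern-of G)          ≡⟨ cong (λ s → + 2 * s) (sumVec-sumAlong G w₃ φ₄) ⟩
  + 2 * (+ 3 * sumVec (sumAlong w₄ φ₅ ∘ pattern-of G))  ≡⟨ *-assoc-≡ (+ 2) (+ 3) _ refl ⟩
  + 6 * sumVec (sumAlong w₄ φ₅ ∘ pattern-of G)          ≡⟨ cong (λ s → + 6 * s) (sumVec-sumAlong G w₄ φ₅) ⟩
  + 6 * (+ 4 * sumVec (sumAlong w₅ φ ∘ pattern-of G))   ≡⟨ *-assoc-≡ (+ 6) (+ 4) _ refl ⟩
  + 24 * sumVec (sumAlong w₅ φ ∘ pattern-of G)          ≡⟨ cong (λ s → + 24 * s) (sumVec-sumAlong G w₅ φ) ⟩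
  + 24 * (+ 5 * sumVec (φ ∘ pattern-of G))              ≡⟨ *-assoc-≡ (+ 24) (+ 5) _ refl ⟩
  + 120 * sumVec (φ ∘ pattern-of G)                     ∎
  where
  open ≡-Reasoning
  w₂ w₃ w₄ w₅ : List (Fin 4)
  w₂ = 0F ∷ []
  w₃ = 1F ∷ 0F ∷ []
  w₄ = 2F ∷ 1F ∷ 0F ∷ []
  w₅ = 3F ∷ 2F ∷ 1F ∷ 0F ∷ []

  φ₅ φ₄ φ₃ : Pattern → ℤ
  φ₅ = sumAlong w₅ φ
  φ₄ = sumAlong w₄ φ₅
  φ₃ = sumAlong w₃ φ₄

-- The bound on labelled pentagons

TriangleFree : Graph n → Set
TriangleFree G = ∀ {u v w} → u ~[ G ] v → u ~[ G ] w → ¬ (v ~[ G ] w)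

-- Adjacent vertices are distinct by irreflexivity, so three pairwise adjacencies already form an
-- embedding of `K₃`.
K₃-free : (G : Graph n) → Free ((3 , K₃) ∷ []) G → TriangleFree G
K₃-free {n = n} G (K₃⋢G ∷ _) {u} {v} {w} uv uw vw = K₃⋢G (φ , record { injective = injective _ _ ; adjacency = adjacency })
  where
  open Graph G
  φ : Fin 3 → Fin n
  φ = lookup (u ∷ v ∷ w ∷ [])

  adjacency : ∀ i j → i ≢ j → φ i ~ φ j
  adjacency 0F 0F i≢i = ⊥-elim (i≢i refl)
  adjacency 0F 1F _   = uv
  adjacency 0F 2F _   = uw
  adjacency 1F 0F _   = ~-sym uv
  adjacency 1F 1F i≢i = ⊥-elim (i≢i refl)
  adjacency 1F 2F _   = vw
  adjacency 2F 0F _   = ~-sym uw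
  adjacency 2F 1F _   = ~-sym vw
  adjacency 2F 2F i≢i = ⊥-elim (i≢i refl)

  ~⇒≢ : ∀ {i j} → i ~ j → i ≢ j
  ~⇒≢ i~i refl = ~-irr _ i~i

  injective : ∀ i j → φ i ≡ φ j → i ≡ j
  injective 0F 0F _  = refl
  injective 0F 1F eq = ⊥-elim (~⇒≢ uv eq)
  injective 0F 2F eq = ⊥-elim (~⇒≢ uw eq)
  injective 1F 0F eq = ⊥-elim (~⇒≢ uv (sym eq))
  injective 1F 1F _  = refl
  injective 1F 2F eq = ⊥-elim (~⇒≢ vw eq)
  injective 2F 0F eq = ⊥-elim (~⇒≢ uw (sym eq))
  injective 2F 1F eq = ⊥-elim (~⇒≢ vw (sym eq))
  injective 2F 2F _  = refl

pentagonSum : Graph n → ℤ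
pentagonSum G = sumVec (pentagon ∘ pattern-of G)

module _ (G : Graph n) (free : TriangleFree G) where
  private
    not-isTriangle : ∀ u v w → T (not (isTriangle (adjacent G u v) (adjacent G u w) (adjacent G v w)))
    not-isTriangle u v w with Graph._~?_ G u v | Graph._~?_ G u w | Graph._~?_ G v w
    ... | yes uv | yes uw | yes vw = free uv uw vw
    ... | yes _  | yes _  | no  _  = _
    ... | yes _  | no  _  | _      = _
    ... | no  _  | _      | _      = _

    infixr 5 _&_
    _&_ : ∀ {x y} → T x → T y → T (x ∧ y)
    s & t = from T-∧ (s , t)

  -- Holds for tuples with repeated vertices as well, because `TriangleFree` ranges over arbitrary
  -- triples; this is what permits sampling with repetition.
  pattern-of-triangleFree : ∀ v → T (triangleFree (pattern-of G v))
  pattern-of-triangleFree (u ∷ v ∷ w ∷ x ∷ y ∷ []) =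
    not-isTriangle u v w & not-isTriangle u v x & not-isTriangle u v y &
    not-isTriangle u w x & not-isTriangle u w y & not-isTriangle u x y &
    not-isTriangle v w x & not-isTriangle v w y & not-isTriangle v x y &
    not-isTriangle w x y

  -- For each choice of the first three vertices the squares have a nonnegative sum over the last
  -- two, so dropping them only decreases the total.
  sumVec-certificate : ∀ c → c * pentagonSum G ℤ.≤ sumVec (certificate c ∘ pattern-of G)
  sumVec-certificate c = begin
    c * sumVec (pentagon ∘ pattern-of G)
      ≡⟨ ℤ.+-identityʳ _ ⟨
    c * sumVec (pentagon ∘ pattern-of G) + 0ℤ
      ≤⟨ ℤ.+-monoʳ-≤ (c * sumVec (pentagon ∘ pattern-of G)) flags-nonNeg ⟩
    c * sumVec (pentagon ∘ pattern-of G) + sumVec (flags ∘ pattern-of G)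
      ≡⟨ cong (_+ sumVec (flags ∘ pattern-of G)) (sumVec-*ˡ c (pentagon ∘ pattern-of G)) ⟨
    sumVec (λ v → c * pentagon (pattern-of G v)) + sumVec (flags ∘ pattern-of G)
      ≡⟨ sumVec-+ (λ v → c * pentagon (pattern-of G v)) (flags ∘ pattern-of G) ⟨
    sumVec (certificate c ∘ pattern-of G) ∎
    where
    open ℤ.≤-Reasoning
    flags-nonNeg : 0ℤ ℤ.≤ sumVec (flags ∘ pattern-of G)
    flags-nonNeg = sum-nonNeg λ u → sum-nonNeg λ v → sum-nonNeg λ w →
      products-nonNeg (squares (adjacent G u v) (adjacent G u w) (adjacent G v w))
        (adjacent G u) (adjacent G v) (adjacent G w)

  pentagon-bound-from-certificate : ∀ c b → (∀ p → T (triangleFree p) → symmetrise (certificate c) p ℤ.≤ b) →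
                                    + 120 * (c * pentagonSum G) ℤ.≤ + (n ℕ.^ 5) * b
  pentagon-bound-from-certificate c b bound = begin
    + 120 * (c * pentagonSum G)
      ≤⟨ ℤ.*-monoˡ-≤-nonNeg (+ 120) (sumVec-certificate c) ⟩
    + 120 * sumVec (certificate c ∘ pattern-of G)
      ≡⟨ sumVec-symmetrise G (certificate c) ⟨
    sumVec (symmetrise (certificate c) ∘ pattern-of G)
      ≤⟨ sumVec-mono (λ v → bound (pattern-of G v) (pattern-of-triangleFree v)) ⟩
    sumVec {n} {5} (λ _ → b)
      ≡⟨ sumVec-const n 5 b ⟩
    + (n ℕ.^ 5) * b ∎
    where open ℤ.≤-Reasoning

  pentagon-bound : + 3125 * pentagonSum G ℤ.≤ + 10 * + (n ℕ.^ 5)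
  -- The common factor 7488 is cancelled: 120 · 195000 = 7488 · 3125 and 74880 = 7488 · 10.
  pentagon-bound = *-cancel-scaled-≤ (+ 120) (+ 195000) (+ 74880) (+ 3125) (+ 10) (+ 7488)
    (pentagonSum G) (+ (n ℕ.^ 5)) refl refl
    (pentagon-bound-from-certificate (+ 195000) (+ 74880) certificate-bound)

-- Labellings of induced pentagons

infix 4 _≟ⱽ_
_≟ⱽ_ : DecidableEquality (Vec (Fin n) k)
_≟ⱽ_ = Vec.≡-dec Fin._≟_

multiplicity : List (Vec (Fin n) k) → Vec (Fin n) k → ℤ
multiplicity []       v = 0ℤ
multiplicity (x ∷ xs) v = (if does (v ≟ⱽ x) then 1ℤ else 0ℤ) + multiplicity xs v

multiplicity≡0 : ∀ {xs} {v : Vec (Fin n) k} → All (v ≢_) xs → multiplicity xs v ≡ 0ℤ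
multiplicity≡0                     []           = refl
multiplicity≡0 {xs = x ∷ _} {v = v} (v≢x ∷ v∉xs) with v ≟ⱽ x
... | yes v≡x = ⊥-elim (v≢x v≡x)
... | no  _   = trans (ℤ.+-identityˡ _) (multiplicity≡0 v∉xs)

multiplicity≤ : ∀ {f : Vec (Fin n) k → ℤ} → (∀ v → 0ℤ ℤ.≤ f v) → ∀ {xs} → Unique xs →
                All (λ v → 1ℤ ℤ.≤ f v) xs → ∀ v → multiplicity xs v ℤ.≤ f v
multiplicity≤ 0≤f                 []             []             v = 0≤f v
multiplicity≤ {f = f} 0≤f {x ∷ _} (x∉xs ∷ uniq) (1≤fx ∷ 1≤f) v with v ≟ⱽ x
... | yes refl = subst (ℤ._≤ f v) (sym (cong (λ m → 1ℤ + m) (multiplicity≡0 x∉xs))) 1≤fx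
... | no  _    = subst (ℤ._≤ f v) (sym (ℤ.+-identityˡ _)) (multiplicity≤ 0≤f uniq 1≤f v)

length≤sumVec-multiplicity : (xs : List (Vec (Fin n) k)) → + length xs ℤ.≤ sumVec (multiplicity xs)
length≤sumVec-multiplicity {n = n} {k} [] = sumVec-nonNeg {n} {k} λ _ → ℤ.≤-refl
length≤sumVec-multiplicity (x ∷ xs) = subst (+ length (x ∷ xs) ℤ.≤_) (sym (sumVec-+ δ (multiplicity xs)))
  (ℤ.+-mono-≤ 1≤sum-δ (length≤sumVec-multiplicity xs))
  where
  δ : Vec (Fin _) _ → ℤ
  δ v = if does (v ≟ⱽ x) then 1ℤ else 0ℤ

  0≤δ : ∀ v → 0ℤ ℤ.≤ δ v
  0≤δ v with does (v ≟ⱽ x)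
  ... | true  = ℤ.+≤+ ℕ.z≤n
  ... | false = ℤ.≤-refl

  δx≡1 : δ x ≡ 1ℤ
  δx≡1 with x ≟ⱽ x
  ... | yes _   = refl
  ... | no  x≢x = ⊥-elim (x≢x refl)

  1≤sum-δ : 1ℤ ℤ.≤ sumVec δ
  1≤sum-δ = subst (ℤ._≤ sumVec δ) δx≡1 (term≤sumVec 0≤δ x)

-- The multiplicity function of a list without repetitions is its indicator, which lies below `f`,
-- and its values sum to at least the length of the list.
length≤sumVec : ∀ {f : Vec (Fin n) k → ℤ} → (∀ v → 0ℤ ℤ.≤ f v) → ∀ {xs} → Unique xs →
                All (λ v → 1ℤ ℤ.≤ f v) xs → + length xs ℤ.≤ sumVec f
length≤sumVec 0≤f {xs} uniq 1≤f =
  ℤ.≤-trans (length≤sumVec-multiplicity xs) (sumVec-mono (multiplicity≤ 0≤f uniq 1≤f))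

pentagon-nonNeg : ∀ p → 0ℤ ℤ.≤ pentagon p
pentagon-nonNeg p = ℤ.≤ᵇ⇒≤ (everywhere-sound (λ p → 0ℤ ℤ.≤ᵇ pentagon p) _ p)

-- The automorphisms of `C₅`: five rotations, then five reflections.
dihedral : List (Vec (Fin 5) 5)
dihedral =
    (0F ∷ 1F ∷ 2F ∷ 3F ∷ 4F ∷ [])
  ∷ (1F ∷ 2F ∷ 3F ∷ 4F ∷ 0F ∷ [])
  ∷ (2F ∷ 3F ∷ 4F ∷ 0F ∷ 1F ∷ [])
  ∷ (3F ∷ 4F ∷ 0F ∷ 1F ∷ 2F ∷ [])
  ∷ (4F ∷ 0F ∷ 1F ∷ 2F ∷ 3F ∷ [])
  ∷ (4F ∷ 3F ∷ 2F ∷ 1F ∷ 0F ∷ [])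
  ∷ (3F ∷ 2F ∷ 1F ∷ 0F ∷ 4F ∷ [])
  ∷ (2F ∷ 1F ∷ 0F ∷ 4F ∷ 3F ∷ [])
  ∷ (1F ∷ 0F ∷ 4F ∷ 3F ∷ 2F ∷ [])
  ∷ (0F ∷ 4F ∷ 3F ∷ 2F ∷ 1F ∷ [])
  ∷ []

dihedral-unique : Unique dihedral
dihedral-unique = from-yes (unique? _≟ⱽ_ dihedral)

dihedral-surjective : All (λ ρ → ∀ i → ∃ λ j → lookup ρ j ≡ i) dihedral
dihedral-surjective = from-yes (All.all? (λ ρ → Fin.all? λ i → Fin.any? λ j → lookup ρ j Fin.≟ i) dihedral)

dihedral-pentagon : All (λ ρ → pentagon (pattern-of C₅ ρ) ≡ 1ℤ) dihedral
dihedral-pentagon = from-yes (All.all? (λ ρ → pentagon (pattern-of C₅ ρ) ℤ.≟ 1ℤ) dihedral)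

Enumerates : Vec (Fin n) k → Subset n → Set
Enumerates v S = ∀ u → u ∈ S ⇔ ∃ λ j → lookup v j ≡ u

-- Makes the labellings of distinct copies distinct, so no labelled pentagon is counted for two
-- vertex sets.
enumerates-injective : (v : Vec (Fin n) k) {S S′ : Subset n} → Enumerates v S → Enumerates v S′ → S ≡ S′
enumerates-injective v e e′ = ⊆-antisym (λ {u} → from (e′ u) ∘ to (e u)) (λ {u} → from (e u) ∘ to (e′ u))

map-injective : ∀ {φ : Fin k → Fin n} → (∀ {i j} → φ i ≡ φ j → i ≡ j) → ∀ {m} {v w : Vec (Fin k) m} →
                Vec.map φ v ≡ Vec.map φ w → v ≡ w
map-injective inj {v = []}    {[]}    _  = refl
map-injective inj {v = _ ∷ _} {_ ∷ _} eq =
  cong₂ _∷_ (inj (Vec.∷-injectiveˡ eq)) (map-injective inj (Vec.∷-injectiveʳ eq))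

module _ {G : Graph n} {S : Subset n} {φ : Fin 5 → Fin n} (copy : IsInducedCopy C₅ G S φ) where
  open IsInducedCopy copy

  pattern-of-map : ∀ ρ → pattern-of G (Vec.map φ ρ) ≡ pattern-of C₅ ρ
  pattern-of-map (a ∷ b ∷ c ∷ d ∷ e ∷ []) =
    cong₂ _∷_ (eq a b) (cong₂ _∷_ (eq a c) (cong₂ _∷_ (eq a d) (cong₂ _∷_ (eq a e) (cong₂ _∷_ (eq b c)
    (cong₂ _∷_ (eq b d) (cong₂ _∷_ (eq b e) (cong₂ _∷_ (eq c d) (cong₂ _∷_ (eq c e) (cong₂ _∷_ (eq d e)
    refl)))))))))
    where
    eq : ∀ i j → adjacent G (φ i) (φ j) ≡ adjacent C₅ i j
    eq i j = does-⇔ (mk⇔ (from (adjacency i j)) (to (adjacency i j)))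
      (Graph._~?_ G (φ i) (φ j)) (Graph._~?_ C₅ i j)

  enumerates-map : (ρ : Vec (Fin 5) 5) → (∀ i → ∃ λ j → lookup ρ j ≡ i) → Enumerates (Vec.map φ ρ) S
  enumerates-map ρ surj u = mk⇔ index (λ (j , eq) → from (image u) (lookup ρ j , trans (sym (Vec.lookup-map j φ ρ)) eq))
    where
    index : u ∈ S → ∃ λ j → lookup (Vec.map φ ρ) j ≡ u
    index u∈S with to (image u) u∈S
    ... | i , φi≡u with surj i
    ...   | j , ρj≡i = j , trans (Vec.lookup-map j φ ρ) (trans (cong φ ρj≡i) φi≡u)

  labellings : List (Vec (Fin n) 5)
  labellings = map (Vec.map φ) dihedral

  labellings-unique : Unique labellings
  labellings-unique = Unique.map⁺ (map-injective injective) dihedral-unique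

  labellings-pentagon : All (λ v → 1ℤ ℤ.≤ pentagon (pattern-of G v)) labellings
  labellings-pentagon = All.map⁺ {f = Vec.map φ} (All.map
    (λ {ρ} eq → ℤ.≤-reflexive (sym (trans (cong pentagon (pattern-of-map ρ)) eq))) dihedral-pentagon)

  labellings-enumerate : All (λ (v : Vec (Fin n) 5) → Enumerates v S) labellings
  labellings-enumerate = All.map⁺ {f = Vec.map φ} (All.map (λ {ρ} → enumerates-map ρ) dihedral-surjective)

-- Ten labellings are added for each copy. The last component remembers that every labelling
-- enumerates some listed set; it is the part of the induction hypothesis that gives disjointness
-- from the labellings of a new set.
all-labellings : (G : Graph n) → ∀ {Ss} → Unique Ss → All (Induces C₅ G) Ss →
  ∃ λ vs → Unique vs × length vs ≡ length Ss ℕ.* 10 ×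
    All (λ v → 1ℤ ℤ.≤ pentagon (pattern-of G v)) vs × All (λ v → Any (Enumerates v) Ss) vs
all-labellings G []            []                   = [] , [] , refl , [] , []
all-labellings G (S∉Ss ∷ uniq) ((φ , copy) ∷ induced) with all-labellings G uniq induced
... | vs , vs-unique , length-vs , vs-pentagon , vs-enumerate =
  labellings copy ++ vs
  , Unique.++⁺ (labellings-unique copy) vs-unique disjoint
  , trans (List.length-++ (labellings copy) {vs}) (cong (10 ℕ.+_) length-vs)
  , All.++⁺ (labellings-pentagon copy) vs-pentagon
  , All.++⁺ (All.map Any.here (labellings-enumerate copy)) (All.map Any.there vs-enumerate)
  where
  disjoint : ∀ {v} → ¬ (v List.∈ labellings copy × v List.∈ vs)
  disjoint {v} (v∈ , v∈vs) = All.lookupWith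
    (λ S≢S′ e′ → S≢S′ (enumerates-injective v (All.lookup (labellings-enumerate copy) v∈) e′))
    S∉Ss (All.lookup vs-enumerate v∈vs)

vecs-unique : {xs : List A} → Unique xs → ∀ n → Unique (vecs xs n)
vecs-unique uniq zero    = [] ∷ []
vecs-unique uniq (suc n) = Unique.cartesianProductWith⁺ _∷_ Vec.∷-injective uniq (vecs-unique uniq n)

copies≤pentagonSum : (G : Graph n) → + (#copies C₅ G ℕ.* 10) ℤ.≤ pentagonSum G
copies≤pentagonSum {n = n} G = bound (all-labellings G copies-unique copies-induced)
  where
  copy? : (S : Subset n) → Dec (∣ S ∣ ≡ 5 × Induces C₅ G S)
  copy? S = (∣ S ∣ ℕ.≟ 5) ×-dec induces? C₅ G S

  copies-unique : Unique (copies C₅ G)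
  copies-unique = Unique.filter⁺ copy? (vecs-unique (((λ ()) ∷ []) ∷ [] ∷ []) n)

  copies-induced : All (Induces C₅ G) (copies C₅ G)
  copies-induced = All.map proj₂ (All.all-filter copy? (subsets n))

  bound : _ → + (#copies C₅ G ℕ.* 10) ℤ.≤ pentagonSum G
  bound (vs , vs-unique , length-vs , vs-pentagon , _) = subst (λ l → + l ℤ.≤ pentagonSum G) length-vs
    (length≤sumVec (pentagon-nonNeg ∘ pattern-of G) vs-unique vs-pentagon)

copies-bound : (G : Graph n) → TriangleFree G → 3125 ℕ.* #copies C₅ G ℕ.≤ n ℕ.^ 5
copies-bound {n = n} G free = ℕ.*-cancelʳ-≤ (3125 ℕ.* c) (n ℕ.^ 5) 10 (ℤ.drop‿+≤+ (begin
  + (3125 ℕ.* c ℕ.* 10)    ≡⟨ cong +_ (ℕ.*-assoc 3125 c 10) ⟩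
  + (3125 ℕ.* (c ℕ.* 10))  ≡⟨ ℤ.pos-* 3125 (c ℕ.* 10) ⟩
  + 3125 * + (c ℕ.* 10)    ≤⟨ ℤ.*-monoˡ-≤-nonNeg (+ 3125) (copies≤pentagonSum G) ⟩
  + 3125 * pentagonSum G   ≤⟨ pentagon-bound G free ⟩
  + 10 * + (n ℕ.^ 5)       ≡⟨ ℤ.pos-* 10 (n ℕ.^ 5) ⟨
  + (10 ℕ.* n ℕ.^ 5)       ≡⟨ cong +_ (ℕ.*-comm 10 (n ℕ.^ 5)) ⟩
  + (n ℕ.^ 5 ℕ.* 10)       ∎))
  where
  open ℤ.≤-Reasoning
  c : ℕ
  c = #copies C₅ G

-- Passage to the limit

-- Witnesses that a triangle-free graph exists on every number of vertices, as `ex-attained`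
-- requires.
emptyGraph : ∀ n → Graph n
emptyGraph n = record
  { _~_   = λ _ _ → ⊥
  ; ~-sym = λ ()
  ; ~-irr = λ _ ()
  ; _~?_  = λ _ _ → no λ ()
  }

emptyGraph-K₃-free : ∀ n → Free ((3 , K₃) ∷ []) (emptyGraph n)
emptyGraph-K₃-free n = (λ (_ , e) → IsEmbedding.adjacency e 0F 1F λ ()) ∷ []

ex-elim : (A : Graph k) (F : Family) (P : ℕ → Set) → ∃ (Free {n} F) →
          ((G : Graph n) → Free F G → P (#copies A G)) → P (ex A F n)
ex-elim A F P exists step with ex-attained A F exists
... | G , free , eq = subst P eq (step G free)

ex-bound : ∀ n → 3125 ℕ.* ex C₅ ((3 , K₃) ∷ []) n ℕ.≤ n ^ 5
ex-bound n = ex-elim C₅ ((3 , K₃) ∷ []) (λ c → 3125 ℕ.* c ℕ.≤ n ^ 5)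
  (emptyGraph n , emptyGraph-K₃-free n) (λ G free → copies-bound G (K₃-free G free))

-- Powers and binomial coefficients

-- A discrete mean value inequality for the power function. In the induction one factor `m ℕ.+ j` is
-- split; its part `m` meets the induction hypothesis and is then bounded by `m ℕ.+ j` in the error
-- term.
[m+j]^[1+k]≤ : ∀ m j k → (m ℕ.+ j) ^ suc k ℕ.≤ m ^ suc k ℕ.+ j ℕ.* suc k ℕ.* (m ℕ.+ j) ^ k
[m+j]^[1+k]≤ m j zero    = ℕ.≤-reflexive (solve 2 (λ m j → (m :+ j) :* con 1 := m :* con 1 :+ j :* con 1 :* con 1) refl m j)
  where open ℕ-Solver.+-*-Solver
[m+j]^[1+k]≤ m j (suc k) = begin
  (m ℕ.+ j) ℕ.* x
    ≡⟨ ℕ.*-distribʳ-+ x m j ⟩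
  m ℕ.* x ℕ.+ j ℕ.* x
    ≤⟨ ℕ.+-monoˡ-≤ (j ℕ.* x) (ℕ.*-monoʳ-≤ m ([m+j]^[1+k]≤ m j k)) ⟩
  m ℕ.* (m ^ suc k ℕ.+ j ℕ.* suc k ℕ.* y) ℕ.+ j ℕ.* x
    ≤⟨ ℕ.+-monoˡ-≤ (j ℕ.* x) (ℕ.≤-trans (ℕ.≤-reflexive (ℕ.*-distribˡ-+ m (m ^ suc k) _))
         (ℕ.+-monoʳ-≤ (m ^ suc (suc k)) step)) ⟩
  m ^ suc (suc k) ℕ.+ j ℕ.* suc k ℕ.* x ℕ.+ j ℕ.* x
    ≡⟨ solve 4 (λ a j k x → a :+ j :* (con 1 :+ k) :* x :+ j :* x := a :+ j :* (con 2 :+ k) :* x)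
         refl (m ^ suc (suc k)) j k x ⟩
  m ^ suc (suc k) ℕ.+ j ℕ.* suc (suc k) ℕ.* x ∎
  where
  open ℕ.≤-Reasoning
  open ℕ-Solver.+-*-Solver
  x y : ℕ
  x = (m ℕ.+ j) ^ suc k
  y = (m ℕ.+ j) ^ k

  step : m ℕ.* (j ℕ.* suc k ℕ.* y) ℕ.≤ j ℕ.* suc k ℕ.* x
  step = begin
    m ℕ.* (j ℕ.* suc k ℕ.* y)          ≤⟨ ℕ.*-monoˡ-≤ (j ℕ.* suc k ℕ.* y) (ℕ.m≤m+n m j) ⟩
    (m ℕ.+ j) ℕ.* (j ℕ.* suc k ℕ.* y)  ≡⟨ solve 3 (λ s c y → s :* (c :* y) := c :* (s :* y)) refl (m ℕ.+ j) (j ℕ.* suc k) y ⟩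
    j ℕ.* suc k ℕ.* x                  ∎

-- Induction along Pascal's rule: the growth of the power from `m` to `suc m` is at most the term
-- that the rule adds on the right.
m^k≤k!*[m+k]Ck : ∀ m k → m ^ k ℕ.≤ k ! ℕ.* ((m ℕ.+ k) C k)
m^k≤k!*[m+k]Ck m       zero    = ℕ.≤-refl
m^k≤k!*[m+k]Ck zero    (suc k) = ℕ.z≤n
m^k≤k!*[m+k]Ck (suc m) (suc k) = begin
  suc m ^ suc k
    ≡⟨ cong (_^ suc k) (ℕ.+-comm 1 m) ⟩
  (m ℕ.+ 1) ^ suc k
    ≤⟨ [m+j]^[1+k]≤ m 1 k ⟩
  m ^ suc k ℕ.+ 1 ℕ.* suc k ℕ.* (m ℕ.+ 1) ^ k
    ≡⟨ cong₂ (λ a b → m ^ suc k ℕ.+ a ℕ.* b ^ k) (ℕ.*-identityˡ (suc k)) (ℕ.+-comm m 1) ⟩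
  m ^ suc k ℕ.+ suc k ℕ.* suc m ^ k
    ≤⟨ ℕ.+-mono-≤ (m^k≤k!*[m+k]Ck m (suc k)) (ℕ.*-monoʳ-≤ (suc k) (m^k≤k!*[m+k]Ck (suc m) k)) ⟩
  suc k ! ℕ.* ((m ℕ.+ suc k) C suc k) ℕ.+ suc k ℕ.* (k ! ℕ.* ((suc m ℕ.+ k) C k))
    ≡⟨ cong (λ l → suc k ! ℕ.* ((m ℕ.+ suc k) C suc k) ℕ.+ suc k ℕ.* (k ! ℕ.* (l C k))) (sym (ℕ.+-suc m k)) ⟩
  suc k ! ℕ.* ((m ℕ.+ suc k) C suc k) ℕ.+ suc k ℕ.* (k ! ℕ.* ((m ℕ.+ suc k) C k))
    ≡⟨ solve 4 (λ s f a b → s :* f :* a :+ s :* (f :* b) := s :* f :* (b :+ a))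
         refl (suc k) (k !) ((m ℕ.+ suc k) C suc k) ((m ℕ.+ suc k) C k) ⟩
  suc k ! ℕ.* ((m ℕ.+ suc k) C k ℕ.+ (m ℕ.+ suc k) C suc k)
    ≡⟨ cong (suc k ! ℕ.*_) (nCk+nC[k+1]≡[n+1]C[k+1] (m ℕ.+ suc k) k) ⟩
  suc k ! ℕ.* ((suc m ℕ.+ suc k) C suc k) ∎
  where
  open ℕ.≤-Reasoning
  open ℕ-Solver.+-*-Solver

-- Replacing n^[1+k] by (n − (1 + k))^[1+k] loses at most (1 + k)² n^k.
n^[1+k]-bound : ∀ k q n → suc k ℕ.* suc k ℕ.* suc q ℕ.≤ n →
                q ℕ.* n ^ suc k ℕ.≤ suc q ℕ.* (suc k ! ℕ.* (n C suc k))
n^[1+k]-bound k q n n≥ = begin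
  q ℕ.* n ^ suc k                                    ≤⟨ ℕ.+-cancelˡ-≤ (n ^ suc k) _ _ shifted ⟩
  suc q ℕ.* m ^ suc k                                ≤⟨ ℕ.*-monoʳ-≤ (suc q) (m^k≤k!*[m+k]Ck m (suc k)) ⟩
  suc q ℕ.* (suc k ! ℕ.* ((m ℕ.+ suc k) C suc k))    ≡⟨ cong (λ l → suc q ℕ.* (suc k ! ℕ.* (l C suc k))) m+[1+k]≡n ⟩
  suc q ℕ.* (suc k ! ℕ.* (n C suc k))                ∎
  where
  open ℕ.≤-Reasoning
  m : ℕ
  m = n ℕ.∸ suc k

  m+[1+k]≡n : m ℕ.+ suc k ≡ n
  m+[1+k]≡n = ℕ.m∸n+n≡m (ℕ.≤-trans (ℕ.m≤m*n (suc k) (suc k)) (ℕ.≤-trans (ℕ.m≤m*n (suc k ℕ.* suc k) (suc q)) n≥))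

  shifted : n ^ suc k ℕ.+ q ℕ.* n ^ suc k ℕ.≤ n ^ suc k ℕ.+ suc q ℕ.* m ^ suc k
  shifted = begin
    suc q ℕ.* n ^ suc k
      ≤⟨ ℕ.*-monoʳ-≤ (suc q) (subst (λ l → l ^ suc k ℕ.≤ m ^ suc k ℕ.+ suc k ℕ.* suc k ℕ.* l ^ k) m+[1+k]≡n
           ([m+j]^[1+k]≤ m (suc k) k)) ⟩
    suc q ℕ.* (m ^ suc k ℕ.+ suc k ℕ.* suc k ℕ.* n ^ k)
      ≡⟨ distribute (suc q) (suc k ℕ.* suc k) (m ^ suc k) (n ^ k) ⟩
    suc k ℕ.* suc k ℕ.* suc q ℕ.* n ^ k ℕ.+ suc q ℕ.* m ^ suc k
      ≤⟨ ℕ.+-monoˡ-≤ (suc q ℕ.* m ^ suc k) (ℕ.*-monoˡ-≤ (n ^ k) n≥) ⟩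
    n ^ suc k ℕ.+ suc q ℕ.* m ^ suc k ∎
    where
    distribute : ∀ s c a b → s ℕ.* (a ℕ.+ c ℕ.* b) ≡ c ℕ.* s ℕ.* b ℕ.+ s ℕ.* a
    distribute = solve 4 (λ s c a b → s :* (a :+ c :* b) := c :* s :* b :+ s :* a) refl
      where open ℕ-Solver.+-*-Solver

-- Rational estimates and the limit

-- In the unnormalised rationals the sum has the literal denominator `b ℕ.* d`, so the hypothesis is
-- exactly the cross-multiplied inequality.
/-≤-/+/ : ∀ e a b c d N .{{_ : ℕ.NonZero b}} .{{_ : ℕ.NonZero d}} .{{_ : ℕ.NonZero N}} →
          e ℕ.* (b ℕ.* d) ℕ.≤ (a ℕ.* d ℕ.+ c ℕ.* b) ℕ.* N →
          + e / N ℚ.≤ + a / b ℚ.+ + c / d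
/-≤-/+/ e a b@(suc _) c d@(suc _) N@(suc _) le = ℚ.toℚᵘ-cancel-≤ (begin
  ℚ.toℚᵘ (+ e / N)                        ≃⟨ ℚ.toℚᵘ-fromℚᵘ (+ e ℚᵘ./ N) ⟩
  + e ℚᵘ./ N                              ≤⟨ ℚᵘ.*≤* cross ⟩
  + a ℚᵘ./ b ℚᵘ.+ + c ℚᵘ./ d              ≃⟨ ℚᵘ.+-cong (ℚ.toℚᵘ-fromℚᵘ (+ a ℚᵘ./ b)) (ℚ.toℚᵘ-fromℚᵘ (+ c ℚᵘ./ d)) ⟨
  ℚ.toℚᵘ (+ a / b) ℚᵘ.+ ℚ.toℚᵘ (+ c / d)  ≃⟨ ℚ.toℚᵘ-homo-+ (+ a / b) (+ c / d) ⟨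
  ℚ.toℚᵘ (+ a / b ℚ.+ + c / d)            ∎)
  where
  open ℚᵘ.≤-Reasoning
  cross : + e ℤ.* + (b ℕ.* d) ℤ.≤ (+ a ℤ.* + d ℤ.+ + c ℤ.* + b) ℤ.* + N
  cross = subst₂ ℤ._≤_ (ℤ.pos-* e (b ℕ.* d))
    (trans (ℤ.pos-* (a ℕ.* d ℕ.+ c ℕ.* b) N)
      (cong (ℤ._* + N) (trans (ℤ.pos-+ (a ℕ.* d) (c ℕ.* b)) (cong₂ ℤ._+_ (ℤ.pos-* a d) (ℤ.pos-* c b)))))
    (ℤ.+≤+ le)

ratio-≤ : ∀ e N a b q → .{{_ : ℕ.NonZero b}} .{{_ : ℕ.NonZero q}} →
          e ℕ.* (b ℕ.* q) ℕ.≤ (a ℕ.* q ℕ.+ 1 ℕ.* b) ℕ.* N → ratio e N ℚ.≤ + a / b ℚ.+ + 1 / q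
-- `ratio` is 0 at denominator 0, treated here as the fraction 0/1.
ratio-≤ e zero      a b q _  = /-≤-/+/ 0 a b 1 q 1 ℕ.z≤n
ratio-≤ e N@(suc _) a b q le = /-≤-/+/ e a b 1 q N le

-- Stated for variables for the same reason as *-cancel-scaled-≤.
combine-bounds : ∀ f a b q e N x {fa fb} .{{_ : ℕ.NonZero f}} → f ℕ.* a ≡ fa → f ℕ.* b ≡ fb → a ℕ.≤ b →
                 fb ℕ.* e ℕ.≤ x → q ℕ.* x ℕ.≤ suc q ℕ.* (fa ℕ.* N) →
                 e ℕ.* (b ℕ.* q) ℕ.≤ (a ℕ.* q ℕ.+ 1 ℕ.* b) ℕ.* N
combine-bounds f a b q e N x refl refl a≤b fbe≤x qx≤ = ℕ.*-cancelˡ-≤ f (begin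
  f ℕ.* (e ℕ.* (b ℕ.* q))                ≡⟨ solve 4 (λ f e b q → f :* (e :* (b :* q)) := q :* (f :* b :* e)) refl f e b q ⟩
  q ℕ.* (f ℕ.* b ℕ.* e)                  ≤⟨ ℕ.*-monoʳ-≤ q fbe≤x ⟩
  q ℕ.* x                                ≤⟨ qx≤ ⟩
  suc q ℕ.* (f ℕ.* a ℕ.* N)              ≡⟨ solve 4 (λ f a q N → (con 1 :+ q) :* (f :* a :* N) := f :* ((a :* q :+ con 1 :* a) :* N)) refl f a q N ⟩
  f ℕ.* ((a ℕ.* q ℕ.+ 1 ℕ.* a) ℕ.* N)    ≤⟨ ℕ.*-monoʳ-≤ f (ℕ.*-monoˡ-≤ N (ℕ.+-monoʳ-≤ (a ℕ.* q) (ℕ.*-monoʳ-≤ 1 a≤b))) ⟩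
  f ℕ.* ((a ℕ.* q ℕ.+ 1 ℕ.* b) ℕ.* N)    ∎)
  where
  open ℕ.≤-Reasoning
  open ℕ-Solver.+-*-Solver

density-bound : ∀ q .{{_ : ℕ.NonZero q}} n → 25 ℕ.* suc q ℕ.≤ n →
                ratio (ex C₅ ((3 , K₃) ∷ []) n) (n C 5) ℚ.≤ + 24 / 625 ℚ.+ + 1 / q
-- The factor 5 is common to 5! = 5 · 24 and 3125 = 5 · 625. The surplus factor (q + 1)/q costs
-- 24/625 · 1/q, at most 1/q as 24 ≤ 625. The threshold 25 is (1 + k)² at k = 4.
density-bound q n n≥ = ratio-≤ e (n C 5) 24 625 q
  (combine-bounds 5 24 625 q e (n C 5) (n ^ 5) refl refl (ℕ.m≤m+n 24 601) (ex-bound n) (n^[1+k]-bound 4 q n n≥))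
  where
  e : ℕ
  e = ex C₅ ((3 , K₃) ∷ []) n

-- A positive fraction has numerator at least 1. This is the Archimedean step that chooses `q` for a
-- given `ε`.
1/denominator≤ : ∀ ε → 0ℚ ℚ.< ε → + 1 / ℚ.↧ₙ ε ℚ.≤ ε
1/denominator≤ ε@(mkℚ (+ zero)      _ _) 0<ε = ⊥-elim (ℚ.<-irrefl refl (ℚ.<-≤-trans 0<ε (ℚ.*≤* (ℤ.+≤+ ℕ.z≤n))))
1/denominator≤ ε@(mkℚ (ℤ.-[1+ _ ])  _ _) 0<ε = ⊥-elim (ℚ.<-asym 0<ε (ℚ.negative⁻¹ ε))
1/denominator≤ ε@(mkℚ (+ suc p) d-1 _) _   = ℚ.toℚᵘ-cancel-≤ (begin
  ℚ.toℚᵘ (+ 1 / suc d-1)  ≃⟨ ℚ.toℚᵘ-fromℚᵘ (+ 1 ℚᵘ./ suc d-1) ⟩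
  + 1 ℚᵘ./ suc d-1        ≤⟨ ℚᵘ.*≤* (ℤ.*-monoʳ-≤-nonNeg (+ suc d-1) {+ 1} {+ suc p} (ℤ.+≤+ (ℕ.s≤s ℕ.z≤n))) ⟩
  ℚ.toℚᵘ ε                ∎)
  where open ℚᵘ.≤-Reasoning

p≤∣p∣ : ∀ p → p ℚ.≤ ℚ.∣ p ∣
p≤∣p∣ p with ℚ.≤-total 0ℚ p
... | inj₁ 0≤p = ℚ.≤-reflexive (sym (ℚ.0≤p⇒∣p∣≡p 0≤p))
... | inj₂ p≤0 = ℚ.≤-trans p≤0 (ℚ.0≤∣p∣ p)

q≤p+∣p-q∣ : ∀ p q → q ℚ.≤ p ℚ.+ ℚ.∣ p ℚ.- q ∣
q≤p+∣p-q∣ p q = begin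
  q                          ≡⟨ solve 2 (λ p q → q := p :+ :- (p :- q)) refl p q ⟩
  p ℚ.+ ℚ.- (p ℚ.- q)        ≤⟨ ℚ.+-monoʳ-≤ p (p≤∣p∣ (ℚ.- (p ℚ.- q))) ⟩
  p ℚ.+ ℚ.∣ ℚ.- (p ℚ.- q) ∣  ≡⟨ cong (λ r → p ℚ.+ r) (ℚ.∣-p∣≡∣p∣ (p ℚ.- q)) ⟩
  p ℚ.+ ℚ.∣ p ℚ.- q ∣        ∎
  where
  open ℚ.≤-Reasoning
  open ℚ-Solver.+-*-Solver

limit-≤ : ∀ {a : ℕ → ℚ} {L : ℝ} b → (λ n → fromℚ (a n)) ⟶ L →
          (∀ ε → 0ℚ ℚ.< ε → ∃ λ N → ∀ n → N ℕ.≤ n → a n ℚ.≤ b ℚ.+ ε) → L ≤ fromℚ b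
limit-≤ {a} {L} b a⟶L a≤b ε 0<ε = proj₁ near , λ m m≥ → begin
  ℝ.seq L m                        ≤⟨ q≤p+∣p-q∣ (a i) (ℝ.seq L m) ⟩
  a i ℚ.+ ℚ.∣ a i ℚ.- ℝ.seq L m ∣  ≤⟨ ℚ.+-mono-≤ (proj₂ (a≤b ε/3 0<ε/3) i (ℕ.m≤n⊔m N₁ N₂)) (proj₂ near m m≥) ⟩
  b ℚ.+ ε/3 ℚ.+ (ε/3 ℚ.+ ε/3)      ≡⟨ solve 2 (λ b ε → b :+ con ⅓ :* ε :+ (con ⅓ :* ε :+ con ⅓ :* ε) := b :+ ε) refl b ε ⟩
  b ℚ.+ ε                          ∎
  where
  open ℚ.≤-Reasoning
  open ℚ-Solver.+-*-Solver

  ⅓ ε/3 : ℚ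
  ⅓ = + 1 / 3
  ε/3 = ⅓ ℚ.* ε

  0<ε/3 : 0ℚ ℚ.< ε/3
  0<ε/3 = ℚ.*-monoʳ-<-pos ⅓ 0<ε

  N₁ N₂ i : ℕ
  N₁ = proj₁ (a⟶L ε/3 0<ε/3)
  N₂ = proj₁ (a≤b ε/3 0<ε/3)
  i = N₁ ℕ.⊔ N₂

  -- With `i` fixed, one `ε/3` comes from the convergence of `a` and one from the slack in `_≤_` on
  -- `ℝ`; the remaining third is spent on comparing `a i` with `b`.
  near : ∃ λ M → ∀ m → M ℕ.≤ m → ℚ.∣ a i ℚ.- ℝ.seq L m ∣ ℚ.≤ ε/3 ℚ.+ ε/3
  near = proj₂ (a⟶L ε/3 0<ε/3) i (ℕ.m≤m⊔n N₁ N₂) ε/3 0<ε/3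

theorem1 : ∀ (π : ℝ) → IsTuránDensity C₅ ((3 , K₃) ∷ []) π → π ≤ fromℚ (+ 24 / 625)
theorem1 π density = limit-≤ {L = π} (+ 24 / 625) density λ ε 0<ε →
  25 ℕ.* suc (ℚ.↧ₙ ε) , λ n n≥ →
    ℚ.≤-trans (density-bound (ℚ.↧ₙ ε) n n≥) (ℚ.+-monoʳ-≤ (+ 24 / 625) (1/denominator≤ ε 0<ε))
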